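{- Let $L$ be a first-order language with equality and let $T$ be a theory axiomatized by $L$-sentences of the form $\forall\vec{x}\,(\psi_0(\vec{x})\to\psi_1(\vec{x}))$, where $\psi_0(\vec{x}),\psi_1(\vec{x})$ are formulas in $\exists^{+}(L)$. Let $\mathcal A=\mathrm{Mod}(T)$ be the full subcategory of $\mathbf{L\text{ - }mod}$ whose objects are the models of $T$. Then $\mathcal A$ has profinite objects, that is, $\mathcal A$ is closed in $\mathbf{L\text{ - }mod}$ under the formation of such limits: for every diagram of finite $L$-structures and $L$-homomorphisms over a downward directed poset, all of whose structures belong to $\mathcal A$, the limit of the diagram in $\mathbf{L\text{ - }mod}$ belongs to $\mathcal A$.
   Context: $L$ is an arbitrary first-order language with equality. $\mathbf{L\text{ - }mod}$ is the category of all $L$-structures (the empty structure is allowed) and $L$-homomorphisms (maps preserving constants and operations, and preserving, not necessarily reflecting, relations). An $L$-formula is existential positive if it is obtained from atomic formulas (including equalities of terms) using the connectives $\wedge,\vee$ and the existential quantifier $\exists$; $\exists^{+}(L)$ denotes the set of all $L$-formulas logically equivalent, in the classical predicate calculus, to an existential positive formula. A poset $\langle I,\le\rangle$ is downward directed if $I\neq\emptyset$ and any two elements have a common lower bound. An $L$-structure is profinite if it is $L$-isomorphic to the limit in $\mathbf{L\text{ - }mod}$ of a diagram of finite $L$-structures over a downward directed poset. -}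

module Defs where

open import Axiom.ExcludedMiddle using (ExcludedMiddle)
open import Data.Bool.Base using (Bool; true; false)
import Data.Bool.Properties as Bool
open import Data.Fin.Base using (Fin)
open import Data.Nat.Base using (ℕ; zero; suc)
open import Data.Product.Base using (Σ; ∃; _×_; _,_; proj₁; proj₂)
open import Data.Sum.Base using (_⊎_; inj₁; inj₂)
open import Data.Vec.Functional using (Vector; []; _∷_)
open import Data.Vec.Functional.Relation.Binary.Pointwise using (Pointwise)
open import Function.Base using (_∘_; id)
open import Function.Bundles using (Func; Inverse; _⇔_)
open import Level using (Level; _⊔_; Lift; lift; lower) renaming (suc to lsuc)
open import Relation.Binary.Bundles using (Setoid; Poset)
open import Relation.Binary.PropositionalEquality as ≡ using (_≡_)
open import Relation.Nullary using (¬_; Dec; yes; no)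
open import Relation.Unary using (Pred; _∈_)

private
  variable
    f r ℓ t k : Level

------------------------------------------------------------------------
-- Classical metatheory

-- Sets are setoids, so the function f is required to respect equality: this
-- is the choice principle of ZFC and not the type-theoretic one, which is
-- provable.  It implies excluded middle (Diaconescu), by which the semantics
-- of formulas below is the classical one.

AxiomOfChoice : (c : Level) → Set (lsuc c)
AxiomOfChoice c =
  (A B : Setoid c c) →
  let module A = Setoid A
      module B = Setoid B
  in
  (R : A.Carrier → B.Carrier → Set c) →
  (∀ {x x′ y y′} → x A.≈ x′ → y B.≈ y′ → R x y → R x′ y′) →
  (∀ x → ∃ λ y → R x y) →
  Σ (Func A B) λ f → ∀ x → R x (Func.to f x)

choice⇒excludedMiddle : ∀ {c} → AxiomOfChoice c → ExcludedMiddle c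
choice⇒excludedMiddle {c} choice {P} = decide
  where
  Carrier : Set c
  Carrier = Lift c Bool

  _~_ : Carrier → Carrier → Set c
  x ~ y = x ≡ y ⊎ P

  ~-sym : ∀ {x y} → x ~ y → y ~ x
  ~-sym (inj₁ e) = inj₁ (≡.sym e)
  ~-sym (inj₂ p) = inj₂ p

  ~-trans : ∀ {x y z} → x ~ y → y ~ z → x ~ z
  ~-trans (inj₁ ≡.refl) q = q
  ~-trans (inj₂ p)      _ = inj₂ p

  A : Setoid c c
  A = record
    { Carrier = Carrier
    ; _≈_ = _~_
    ; isEquivalence = record { refl = inj₁ ≡.refl ; sym = ~-sym ; trans = ~-trans }
    }

  section : Σ (Func A (≡.setoid Carrier)) λ s → ∀ x → x ~ Func.to s x
  section = choice A (≡.setoid Carrier) _~_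
    (λ x~x′ y≡y′ x~y → ~-trans (~-sym x~x′) (~-trans x~y (inj₁ y≡y′)))
    (λ x → x , inj₁ ≡.refl)

  open Func (proj₁ section) renaming (to to s; cong to s-cong)

  tt′ ff′ : Carrier
  tt′ = lift true
  ff′ = lift false

  collapse : s tt′ ≡ s ff′ → tt′ ~ ff′
  collapse e = ~-trans (proj₂ section tt′)
    (~-trans (inj₁ e) (~-sym (proj₂ section ff′)))

  decide : Dec P
  decide with lower (s tt′) Bool.≟ lower (s ff′)
  ... | no  ne = no λ p → ne (≡.cong lower (s-cong (inj₂ p)))
  ... | yes e with collapse (≡.cong lift e)
  ...   | inj₁ ()
  ...   | inj₂ p = yes p

------------------------------------------------------------------------
-- Syntax

-- Symbols are indexed by their arity; the constants are those in Fun 0.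

record Language (f r : Level) : Set (lsuc (f ⊔ r)) where
  field
    Fun : ℕ → Set f
    Rel : ℕ → Set r

-- Term L n and Formula L n have their free variables among n variables (de
-- Bruijn indices).

data Term (L : Language f r) (n : ℕ) : Set f where
  var : Fin n → Term L n
  app : ∀ {m} → Language.Fun L m → Vector (Term L n) m → Term L n

infix  8 _≐_
infix  7 ~_
infixr 6 _∧_
infixr 5 _∨_
infixr 4 _⇒_

data Formula (L : Language f r) (n : ℕ) : Set (f ⊔ r) where
  _≐_         : Term L n → Term L n → Formula L n
  atom        : ∀ {m} → Language.Rel L m → Vector (Term L n) m → Formula L n
  ~_          : Formula L n → Formula L n
  _∧_ _∨_ _⇒_ : Formula L n → Formula L n → Formula L n
  all ex      : Formula L (suc n) → Formula L n

Sentence : Language f r → Set (f ⊔ r)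
Sentence L = Formula L 0

∀* : ∀ {L : Language f r} {n} → Formula L n → Sentence L
∀* {n = zero}  φ = φ
∀* {n = suc n} φ = ∀* (all φ)

data ExistentialPositive {L : Language f r} {n : ℕ} : Formula L n → Set (f ⊔ r) where
  _≐_  : ∀ s t → ExistentialPositive (s ≐ t)
  atom : ∀ {m} (R : Language.Rel L m) ts → ExistentialPositive (atom R ts)
  _∧_  : ∀ {φ ψ} → ExistentialPositive φ → ExistentialPositive ψ → ExistentialPositive (φ ∧ ψ)
  _∨_  : ∀ {φ ψ} → ExistentialPositive φ → ExistentialPositive ψ → ExistentialPositive (φ ∨ ψ)
  ex   : ∀ {φ} → ExistentialPositive φ → ExistentialPositive (ex φ)

------------------------------------------------------------------------
-- Structures and satisfaction

record Structure (L : Language f r) (ℓ : Level) : Set (f ⊔ r ⊔ lsuc ℓ) where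
  open Language L
  field
    domain : Setoid ℓ ℓ
  open Setoid domain public
  field
    fun      : ∀ {m} → Fun m → Vector Carrier m → Carrier
    fun-cong : ∀ {m} (F : Fun m) {xs ys} → Pointwise _≈_ xs ys → fun F xs ≈ fun F ys
    rel      : ∀ {m} → Rel m → Vector Carrier m → Set ℓ
    rel-resp : ∀ {m} (R : Rel m) {xs ys} → Pointwise _≈_ xs ys → rel R xs → rel R ys

Finite : {L : Language f r} → Structure L ℓ → Set ℓ
Finite M = ∃ λ n → Inverse (≡.setoid (Fin n)) (Structure.domain M)

module _ {L : Language f r} (M : Structure L ℓ) where
  private module M = Structure M

  ⟦_⟧ : ∀ {n} → Term L n → Vector M.Carrier n → M.Carrier
  ⟦ var i ⟧    ρ = ρ i
  ⟦ app F ts ⟧ ρ = M.fun F (λ i → ⟦ ts i ⟧ ρ)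

  Satisfies : ∀ {n} → Formula L n → Vector M.Carrier n → Set ℓ
  Satisfies (s ≐ t)     ρ = ⟦ s ⟧ ρ M.≈ ⟦ t ⟧ ρ
  Satisfies (atom R ts) ρ = M.rel R (λ i → ⟦ ts i ⟧ ρ)
  Satisfies (~ φ)       ρ = ¬ Satisfies φ ρ
  Satisfies (φ ∧ ψ)     ρ = Satisfies φ ρ × Satisfies ψ ρ
  Satisfies (φ ∨ ψ)     ρ = Satisfies φ ρ ⊎ Satisfies ψ ρ
  Satisfies (φ ⇒ ψ)     ρ = Satisfies φ ρ → Satisfies ψ ρ
  Satisfies (all φ)     ρ = ∀ x → Satisfies φ (x ∷ ρ)
  Satisfies (ex φ)      ρ = ∃ λ x → Satisfies φ (x ∷ ρ)

infix 3 _⊨_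

_⊨_ : {L : Language f r} → Structure L ℓ → Sentence L → Set ℓ
M ⊨ σ = Satisfies M σ []

Theory : Language f r → (t : Level) → Set (f ⊔ r ⊔ lsuc t)
Theory L t = Pred (Sentence L) t

Mod : {L : Language f r} → Theory L t → (ℓ : Level) → Pred (Structure L ℓ) (f ⊔ r ⊔ t ⊔ ℓ)
Mod T ℓ M = ∀ σ → σ ∈ T → M ⊨ σ

------------------------------------------------------------------------
-- Formulas equivalent to existential positive ones

-- The classical predicate calculus is the calculus of nonempty structures.
-- Omitting the point of the domain would change the notion for sentences
-- only, and would give fewer formulas in ∃⁺.

LogicallyEquivalent : {L : Language f r} (ℓ : Level) → ∀ {n} →
                      Formula L n → Formula L n → Set (f ⊔ r ⊔ lsuc ℓ)
LogicallyEquivalent {L = L} ℓ φ ψ =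
  (M : Structure L ℓ) → Structure.Carrier M →
  ∀ ρ → Satisfies M φ ρ ⇔ Satisfies M ψ ρ

∃⁺ : {L : Language f r} (ℓ : Level) → ∀ {n} → Pred (Formula L n) (f ⊔ r ⊔ lsuc ℓ)
∃⁺ ℓ φ = ∃ λ ψ → ExistentialPositive ψ × LogicallyEquivalent ℓ φ ψ

data ∃⁺-Implication {L : Language f r} (ℓ : Level) : Pred (Sentence L) (f ⊔ r ⊔ lsuc ℓ) where
  implication : ∀ {n} (ψ₀ ψ₁ : Formula L n) → ψ₀ ∈ ∃⁺ ℓ → ψ₁ ∈ ∃⁺ ℓ →
                ∃⁺-Implication ℓ (∀* (ψ₀ ⇒ ψ₁))

------------------------------------------------------------------------
-- The category L-mod

record Hom {L : Language f r} (M N : Structure L ℓ) : Set (f ⊔ r ⊔ ℓ) where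
  open Language L
  private
    module M = Structure M
    module N = Structure N
  field
    to       : M.Carrier → N.Carrier
    to-cong  : ∀ {x y} → x M.≈ y → to x N.≈ to y
    fun-homo : ∀ {m} (F : Fun m) xs → to (M.fun F xs) N.≈ N.fun F (to ∘ xs)
    rel-homo : ∀ {m} (R : Rel m) xs → M.rel R xs → N.rel R (to ∘ xs)

infix 4 _≃_

_≃_ : {L : Language f r} {M N : Structure L ℓ} → Hom M N → Hom M N → Set ℓ
_≃_ {N = N} g h = ∀ x → Structure._≈_ N (Hom.to g x) (Hom.to h x)

idHom : {L : Language f r} (M : Structure L ℓ) → Hom M M
idHom M = record
  { to       = id
  ; to-cong  = id
  ; fun-homo = λ F xs → Structure.refl M
  ; rel-homo = λ R xs → id
  }

infixr 9 _⊚_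

_⊚_ : {L : Language f r} {M N P : Structure L ℓ} → Hom N P → Hom M N → Hom M P
_⊚_ {P = P} g h = record
  { to       = Hom.to g ∘ Hom.to h
  ; to-cong  = Hom.to-cong g ∘ Hom.to-cong h
  ; fun-homo = λ F xs → Structure.trans P (Hom.to-cong g (Hom.fun-homo h F xs))
                                          (Hom.fun-homo g F (Hom.to h ∘ xs))
  ; rel-homo = λ R xs → Hom.rel-homo g R (Hom.to h ∘ xs) ∘ Hom.rel-homo h R xs
  }

------------------------------------------------------------------------
-- Limits over downward directed posets

record DownwardDirected (I : Poset ℓ ℓ ℓ) : Set ℓ where
  open Poset I
  field
    inhabitant : Carrier
    lowerBound : ∀ i j → ∃ λ l → l ≤ i × l ≤ j

-- Taking s arbitrary in map-∘ makes map independent of the proof of i ≤ j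
-- (let p be reflexivity), as it should be for a functor on a poset.

record Diagram (L : Language f r) (I : Poset ℓ ℓ ℓ) : Set (f ⊔ r ⊔ lsuc ℓ) where
  open Poset I
  field
    obj    : Carrier → Structure L ℓ
    map    : ∀ {i j} → i ≤ j → Hom (obj i) (obj j)
    map-id : ∀ {i} (p : i ≤ i) → map p ≃ idHom (obj i)
    map-∘  : ∀ {i j l} (p : i ≤ j) (q : j ≤ l) (s : i ≤ l) → map s ≃ map q ⊚ map p

module _ {L : Language f r} {I : Poset ℓ ℓ ℓ} (D : Diagram L I) where
  private
    module I = Poset I
    module D = Diagram D

  record Cone : Set (f ⊔ r ⊔ lsuc ℓ) where
    field
      apex    : Structure L ℓ
      proj    : ∀ i → Hom apex (D.obj i)
      commute : ∀ {i j} (p : i I.≤ j) → D.map p ⊚ proj i ≃ proj j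

  record IsLimit (C : Cone) : Set (f ⊔ r ⊔ lsuc ℓ) where
    open Cone
    field
      mediator : (C′ : Cone) → Hom (apex C′) (apex C)
      factor   : (C′ : Cone) → ∀ i → proj C i ⊚ mediator C′ ≃ proj C′ i
      unique   : (C′ : Cone) (h : Hom (apex C′) (apex C)) →
                 (∀ i → proj C i ⊚ h ≃ proj C′ i) → h ≃ mediator C′

  -- Limits exist: they are the structures of compatible families.

  private module A (i : I.Carrier) = Structure (D.obj i)

  Family : Set ℓ
  Family = Σ (∀ i → A.Carrier i) λ x →
           ∀ {i j} (p : i I.≤ j) → A._≈_ j (Hom.to (D.map p) (x i)) (x j)

  limitStructure : Structure L ℓ
  limitStructure = record
    { domain = record
      { Carrier = Family
      ; _≈_ = λ x y → ∀ i → A._≈_ i (proj₁ x i) (proj₁ y i)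
      ; isEquivalence = record
        { refl  = λ i → A.refl i
        ; sym   = λ e i → A.sym i (e i)
        ; trans = λ e e′ i → A.trans i (e i) (e′ i)
        }
      }
    ; fun = λ F xs →
        (λ i → A.fun i F (λ m → proj₁ (xs m) i)) ,
        (λ {i} {j} p → A.trans j (Hom.fun-homo (D.map p) F _)
                                 (A.fun-cong j F (λ m → proj₂ (xs m) p)))
    ; fun-cong = λ F e i → A.fun-cong i F (λ m → e m i)
    ; rel = λ R xs → ∀ i → A.rel i R (λ m → proj₁ (xs m) i)
    ; rel-resp = λ R e h i → A.rel-resp i R (λ m → e m i) (h i)
    }

  limitCone : Cone
  limitCone = record
    { apex    = limitStructure
    ; proj    = λ i → record
      { to       = λ x → proj₁ x i
      ; to-cong  = λ e → e i
      ; fun-homo = λ F xs → A.refl i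
      ; rel-homo = λ R xs h → h i
      }
    ; commute = λ p x → proj₂ x p
    }

  limitCone-isLimit : IsLimit limitCone
  limitCone-isLimit = record
    { mediator = λ C′ → let open Cone C′ in record
      { to       = λ x → (λ i → Hom.to (proj i) x) , (λ p → commute p x)
      ; to-cong  = λ e i → Hom.to-cong (proj i) e
      ; fun-homo = λ F xs i → Hom.fun-homo (proj i) F xs
      ; rel-homo = λ R xs h i → Hom.rel-homo (proj i) R xs h
      }
    ; factor = λ C′ i x → A.refl i
    ; unique = λ C′ h e x i → e i x
    }

HasProfiniteObjects : {L : Language f r} → Pred (Structure L ℓ) k → Set (f ⊔ r ⊔ lsuc ℓ ⊔ k)
HasProfiniteObjects {ℓ = ℓ} {L = L} 𝒜 =
  (I : Poset ℓ ℓ ℓ) → DownwardDirected I →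
  (D : Diagram L I) →
  (∀ i → Finite (Diagram.obj D i)) →
  (∀ i → Diagram.obj D i ∈ 𝒜) →
  (C : Cone D) → IsLimit D C → Cone.apex C ∈ 𝒜

{-# OPTIONS --safe #-}

-- An existential positive formula that holds at every stage of a limit of
-- finite structures holds in the limit: the witnesses of an existential
-- quantifier form an inverse system of nonempty finite sets, and a minimal
-- subsystem of it (Zorn) consists of singletons, that is, of a compatible
-- family of witnesses.  Homomorphisms preserve such formulas in the other
-- direction.  As ∃⁺ is about nonempty structures, an empty limit needs a
-- separate argument: there some stage is empty too, and below it the truth
-- value of every sentence, which depends on finitely many nullary relations,
-- stabilises.

module Submission where

open import Axiom.ExcludedMiddle using (ExcludedMiddle)
open import Data.Bool.Base using (Bool; T)
open import Data.Empty using (⊥-elim)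
open import Data.Fin.Base using (Fin; zero; suc)
open import Data.Nat.Base using (zero; suc)
open import Data.Product.Base using (∃; _×_; _,_; proj₁; proj₂)
open import Data.Product.Function.NonDependent.Propositional using (_×-⇔_)
open import Data.Sum.Base as Sum using (_⊎_; inj₁; inj₂)
open import Data.Sum.Function.Propositional using (_⊎-⇔_)
open import Data.Unit.Polymorphic.Base using (⊤; tt)
open import Data.Vec.Functional using (Vector; []; _∷_; head; tail)
open import Data.Vec.Functional.Relation.Binary.Pointwise using (Pointwise)
open import Defs
open import Function.Base using (_∘_; id)
open import Function.Bundles using (Func; Inverse; Equivalence; _⇔_; mk⇔)
open import Function.Related.TypeIsomorphisms using (→-cong-⇔; ¬-cong-⇔)
open import Level using (Level)
open import Relation.Binary.Bundles using (Poset; Setoid)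
open import Relation.Binary.Definitions using (_Respects_)
open import Relation.Binary.PropositionalEquality as ≡ using (_≡_)
open import Relation.Nullary using (¬_; yes; no)
open import Relation.Nullary.Decidable using (⌊_⌋; decidable-stable; toWitness; fromWitness)
open import Relation.Unary using (Pred; _∈_; _⊆_)

private
  variable
    a b f r ℓ : Level

-- Classical logic.

module Classical (choice : ∀ c → AxiomOfChoice c) where

  abstract
    em : ExcludedMiddle a
    em {a} = choice⇒excludedMiddle (choice a)

  ¬∀⇒∃¬ : {A : Set a} {B : A → Set b} → ¬ (∀ x → B x) → ∃ λ x → ¬ B x
  ¬∀⇒∃¬ {B = B} ¬∀ with em {P = ∃ λ x → ¬ B x}
  ... | yes ∃¬ = ∃¬
  ... | no ¬∃¬ = ⊥-elim (¬∀ λ x → decidable-stable em λ ¬b → ¬∃¬ (x , ¬b))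

  -- Zorn's lemma, for minimal elements.

  module _ (P : Poset ℓ ℓ ℓ) where
    open Poset P

    module _
      (⋀ : (Carrier → Bool) → Carrier)
      (⋀-lower : ∀ C {x} → T (C x) → ⋀ C ≤ x)
      (⋀-greatest : ∀ C {x} → (∀ y → T (C y) → x ≤ y) → x ≤ ⋀ C)
      (Good : Pred Carrier ℓ) (Good-resp : Good Respects _≈_)
      (⋀-Good : ∀ C → (∀ x y → T (C x) → T (C y) → x ≤ y ⊎ y ≤ x) →
                (∀ x → T (C x) → Good x) → Good (⋀ C))
      where

      IsMinimal : Carrier → Set ℓ
      IsMinimal x = ∀ y → Good y → y ≤ x → x ≤ y

      -- A step that fails to go strictly down certifies that `x` is minimal. Goodness is only
      -- passed on, so that every `x`, good or not, has a step.
      Descent : Carrier → Carrier → Set ℓ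
      Descent x y = y ≤ x × (Good x → Good y) × (x ≤ y → IsMinimal x)

      Descent-resp : ∀ {x x′ y y′} → x ≈ x′ → y ≈ y′ → Descent x y → Descent x′ y′
      Descent-resp x≈x′ y≈y′ (y≤x , good , minimal) =
        trans (reflexive (Eq.sym y≈y′)) (trans y≤x (reflexive x≈x′)) ,
        Good-resp y≈y′ ∘ good ∘ Good-resp (Eq.sym x≈x′) ,
        λ x′≤y′ z gz z≤x′ →
          trans (reflexive (Eq.sym x≈x′))
            (minimal
              (trans (reflexive x≈x′) (trans x′≤y′ (reflexive (Eq.sym y≈y′))))
              z gz (trans z≤x′ (reflexive (Eq.sym x≈x′))))

      descend : ∀ x → ∃ (Descent x)
      descend x with em {P = ∃ λ y → Good y × y ≤ x × ¬ x ≤ y}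
      ... | yes (y , gy , y≤x , x≰y) = y , y≤x , (λ _ → gy) , λ x≤y → ⊥-elim (x≰y x≤y)
      ... | no ∄y = x , refl , id , λ _ → minimal
        where
        minimal : IsMinimal x
        minimal y gy y≤x = decidable-stable em λ x≰y → ∄y (y , gy , y≤x , x≰y)

      -- The choice has to be extensional: Tower-linear compares next x and
      -- next y for x ≈ y.
      descent : ∃ λ g → ∀ x → Descent x (Func.to g x)
      descent = choice ℓ Eq.setoid Eq.setoid Descent Descent-resp descend

      next : Carrier → Carrier
      next = Func.to (proj₁ descent)

      next-≤ : ∀ x → next x ≤ x
      next-≤ x = proj₁ (proj₂ descent x)

      -- The transfinite iteration of `next`, without ordinals. It starts from the top, which is the
      -- meet of the empty family.
      data Tower : Carrier → Set ℓ where
        step : ∀ {x} → Tower x → Tower (next x)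
        inf  : ∀ C → (∀ x → T (C x) → Tower x) → Tower (⋀ C)

      -- Stronger than comparability: no tower element lies strictly between `next y` and `y`.
      -- Comparability alone would not survive the `step` case.
      Tower-linear : ∀ {x y} → Tower x → Tower y → x ≤ next y ⊎ y ≤ x
      Tower-linear (step {x} tx) ty with Tower-linear tx ty
      ... | inj₁ x≤ny = inj₁ (trans (next-≤ x) x≤ny)
      -- The arguments trade places; the recursion is well founded because a `step` has been
      -- removed.
      ... | inj₂ y≤x with Tower-linear ty tx
      ...   | inj₁ y≤nx = inj₂ y≤nx
      ...   | inj₂ x≤y  =
        inj₁ (reflexive (Func.cong (proj₁ descent) (antisym x≤y y≤x)))
      Tower-linear {y = y} (inf C tC) ty with em {P = ∃ λ x → T (C x) × x ≤ next y}
      ... | yes (x , x∈C , x≤ny) = inj₁ (trans (⋀-lower C x∈C) x≤ny)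
      ... | no ∄x = inj₂ (⋀-greatest C λ x x∈C →
        Sum.[ (λ x≤ny → ⊥-elim (∄x (x , x∈C , x≤ny))) , id ] (Tower-linear (tC x x∈C) ty))

      Tower-Good : ∀ {x} → Tower x → Good x
      Tower-Good (step {x} tx) = proj₁ (proj₂ (proj₂ descent x)) (Tower-Good tx)
      Tower-Good (inf C tC)    = ⋀-Good C
        (λ x y x∈C y∈C →
          Sum.map₁ (λ x≤ny → trans x≤ny (next-≤ y)) (Tower-linear (tC x x∈C) (tC y y∈C)))
        (λ x x∈C → Tower-Good (tC x x∈C))

      -- ⋀ takes Bool-valued families only, to stay at level ℓ; em decides Tower.
      tower : Carrier → Bool
      tower x = ⌊ em {P = Tower x} ⌋

      -- The meet of the whole tower belongs to the tower, hence so does its `next`, which therefore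
      -- lies above that meet: this step does not go strictly down.
      minimal : ∃ λ C → Good (⋀ C) × IsMinimal (⋀ C)
      minimal = tower , Tower-Good bottom ,
        proj₂ (proj₂ (proj₂ descent (⋀ tower))) (⋀-lower tower (fromWitness (step bottom)))
        where
        bottom : Tower (⋀ tower)
        bottom = inf tower λ _ → toWitness

  -- Compactness of finite sets.

  module _ (A : Setoid ℓ ℓ) where
    open Setoid A

    -- Otherwise each of the finitely many points is missed by some `S j`, and a set below all of
    -- these would miss every point, although it is inhabited.
    directed⇒commonPoint :
      (∃ λ n → Inverse (≡.setoid (Fin n)) A) →
      {J : Set a} (S : J → Pred Carrier b) → (∀ j → S j Respects _≈_) →
      J → (∀ j k → ∃ λ l → S l ⊆ S j × S l ⊆ S k) →
      (∀ j → ∃ (S j)) → ∃ λ x → ∀ j → S j x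
    directed⇒commonPoint (n , fin) {J} S S-resp j₀ directed inhabited
      with em {P = ∃ λ x → ∀ j → S j x}
    ... | yes common = common
    ... | no ∄x = ⊥-elim (missed (from x) (js≥ (from x)
                     (S-resp _ (sym (strictlyInverseˡ x)) x∈)))
      where
      open Inverse fin

      miss : ∀ k → ∃ λ j → ¬ S j (to k)
      miss k = ¬∀⇒∃¬ λ ∀j → ∄x (to k , ∀j)

      missed : ∀ k → ¬ S (proj₁ (miss k)) (to k)
      missed k = proj₂ (miss k)

      below : ∀ {m} (js : Vector J m) → ∃ λ l → ∀ k → S l ⊆ S (js k)
      below {zero}  js = j₀ , λ ()
      below {suc m} js with below (tail js)
      ... | l , l≤ with directed (head js) l
      ...   | l′ , l′≤j , l′≤l = l′ , λ { zero → l′≤j ; (suc k) → l≤ k ∘ l′≤l }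

      lower = below (proj₁ ∘ miss)
      js≥ : ∀ k → S (proj₁ lower) ⊆ S (proj₁ (miss k))
      js≥ = proj₂ lower
      x = proj₁ (inhabited (proj₁ lower))
      x∈ = proj₂ (inhabited (proj₁ lower))

  -- Inverse systems of nonempty finite sets.

  module _
    {L : Language f r} {I : Poset ℓ ℓ ℓ} (dir : DownwardDirected I) (D : Diagram L I)
    (finite : ∀ i → Finite (Diagram.obj D i))
    where

    private
      module I = Poset I
      module D = Diagram D
      module A (i : I.Carrier) = Structure (D.obj i)
    open DownwardDirected dir

    map : ∀ {i j} → i I.≤ j → A.Carrier i → A.Carrier j
    map p = Hom.to (D.map p)

    map-cong : ∀ {i j} (p : i I.≤ j) {x y} → A._≈_ i x y → A._≈_ j (map p x) (map p y)
    map-cong p = Hom.to-cong (D.map p)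

    map-irrelevant : ∀ {i j} (p q : i I.≤ j) x → A._≈_ j (map p x) (map q x)
    map-irrelevant {j = j} p q x =
      A.trans j (D.map-∘ q I.refl p x) (D.map-id I.refl (map q x))

    module _
      (X : ∀ i → Pred (A.Carrier i) ℓ) (X-resp : ∀ i → X i Respects A._≈_ i)
      (X-closed : ∀ {i j} (p : i I.≤ j) x → X i x → X j (map p x))
      (X-full : ∀ i → ∃ (X i))
      where

      -- Membership is `Bool`-valued to keep subsystems at level `ℓ`, where Zorn's lemma is applied
      -- to them; `em` turns predicates into such families.
      record Subsystem : Set ℓ where
        field
          contains : ∀ i → A.Carrier i → Bool

        _∋_ : ∀ i → A.Carrier i → Set
        i ∋ x = T (contains i x)

        field
          inside : ∀ i x → i ∋ x → X i x
          resp   : ∀ i → (i ∋_) Respects A._≈_ i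
          closed : ∀ {i j} (p : i I.≤ j) x → i ∋ x → j ∋ map p x

      open Subsystem

      Full : Subsystem → Set ℓ
      Full Y = ∀ i → ∃ λ x → (Y ∋ i) x

      subsystem : (Y : ∀ i → Pred (A.Carrier i) a) → (∀ i x → Y i x → X i x) →
                  (∀ i → Y i Respects A._≈_ i) →
                  (∀ {i j} (p : i I.≤ j) x → Y i x → Y j (map p x)) → Subsystem
      subsystem Y Y⊆X Y-resp Y-closed = record
        { contains = λ i x → ⌊ em {P = Y i x} ⌋
        ; inside   = λ i x → Y⊆X i x ∘ toWitness
        ; resp     = λ i x≈y → fromWitness ∘ Y-resp i x≈y ∘ toWitness
        ; closed   = λ p x → fromWitness ∘ Y-closed p x ∘ toWitness
        }

      subsystemPoset : Poset ℓ ℓ ℓ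
      subsystemPoset = record
        { Carrier = Subsystem
        ; _≈_     = λ Y Z → (∀ i x → (Y ∋ i) x → (Z ∋ i) x) × (∀ i x → (Z ∋ i) x → (Y ∋ i) x)
        ; _≤_     = λ Y Z → ∀ i x → (Y ∋ i) x → (Z ∋ i) x
        ; isPartialOrder = record
          { isPreorder = record
            { isEquivalence = record
              { refl  = (λ i x → id) , (λ i x → id)
              ; sym   = λ (p , q) → q , p
              ; trans = λ (p , q) (p′ , q′) →
                  (λ i x → p′ i x ∘ p i x) , (λ i x → q i x ∘ q′ i x)
              }
            ; reflexive = proj₁
            ; trans     = λ p q i x → q i x ∘ p i x
            }
          ; antisym = _,_
          }
        }

      open Poset subsystemPoset using (_≈_; _≤_)

      -- The conjunct `X i x` makes the empty family meet in `X` itself.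
      ⋂ : (Subsystem → Bool) → Subsystem
      ⋂ C = subsystem (λ i x → X i x × ∀ Y → T (C Y) → (Y ∋ i) x)
        (λ i x → proj₁)
        (λ i x≈y (x∈X , x∈) → X-resp i x≈y x∈X , λ Y Y∈C → resp Y i x≈y (x∈ Y Y∈C))
        (λ p x (x∈X , x∈) → X-closed p x x∈X , λ Y Y∈C → closed Y p x (x∈ Y Y∈C))

      -- At each stage a nonempty chain is a directed family of inhabited subsets of a finite set,
      -- so compactness applies. The empty chain falls back on `X-full`.
      ⋂-Full : ∀ C → (∀ Y Z → T (C Y) → T (C Z) → Y ≤ Z ⊎ Z ≤ Y) →
               (∀ Y → T (C Y) → Full Y) → Full (⋂ C)
      ⋂-Full C chain full i with em {P = ∃ λ Y → T (C Y)}
      ... | no ∄Y = let x , x∈X = X-full i in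
        x , fromWitness (x∈X , λ Y Y∈C → ⊥-elim (∄Y (Y , Y∈C)))
      ... | yes (Y₀ , Y₀∈C) =
        let x , x∈ = directed⇒commonPoint (A.domain i) (finite i)
              {J = ∃ λ Y → T (C Y)} (λ (Y , _) → Y ∋ i) (λ (Y , _) → resp Y i)
              (Y₀ , Y₀∈C) directed (λ (Y , Y∈C) → full Y Y∈C i)
        in x , fromWitness (inside Y₀ i x (x∈ (Y₀ , Y₀∈C)) , λ Y Y∈C → x∈ (Y , Y∈C))
        where
        directed : (Y Z : ∃ λ Y → T (C Y)) → ∃ λ ((W , _) : ∃ λ W → T (C W)) →
                   (W ∋ i) ⊆ (proj₁ Y ∋ i) × (W ∋ i) ⊆ (proj₁ Z ∋ i)
        directed (Y , Y∈C) (Z , Z∈C) with chain Y Z Y∈C Z∈C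
        ... | inj₁ Y≤Z = (Y , Y∈C) , id , (λ {x} → Y≤Z i x)
        ... | inj₂ Z≤Y = (Z , Z∈C) , (λ {x} → Z≤Y i x) , id

      Full-resp : Full Respects _≈_
      Full-resp (Y≤Z , _) full i = let x , x∈Y = full i in x , Y≤Z i x x∈Y

      abstract
        minimalSubsystem : ∃ λ C → Full (⋂ C) × (∀ Y → Full Y → Y ≤ ⋂ C → ⋂ C ≤ Y)
        minimalSubsystem = minimal subsystemPoset ⋂
          (λ C Y∈C i x x∈ → proj₂ (toWitness x∈) _ Y∈C)
          (λ C {Y} Y≤ i x x∈Y →
            fromWitness (inside Y i x x∈Y , λ Z Z∈C → Y≤ Z Z∈C i x x∈Y))
          Full (λ {Y} {Z} → Full-resp {Y} {Z}) ⋂-Full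

      Y : Subsystem
      Y = ⋂ (proj₁ minimalSubsystem)

      Y-full : Full Y
      Y-full = proj₁ (proj₂ minimalSubsystem)

      Image : ∀ i → (∃ λ k → k I.≤ i) → Pred (A.Carrier i) ℓ
      Image i (k , p) x = ∃ λ z → (Y ∋ k) z × A._≈_ i (map p z) x

      -- Images shrink as `k` descends, so they form a directed family. A common point has preimages
      -- in `Y` at every stage below `i`.
      imagesMeet : ∀ i → ∃ λ x → ∀ k → Image i k x
      imagesMeet i = directed⇒commonPoint (A.domain i) (finite i) (Image i)
        (λ _ x≈y (z , z∈Y , e) → z , z∈Y , A.trans i e x≈y)
        (i , I.refl) directed
        (λ (k , p) → let z , z∈Y = Y-full k in map p z , z , z∈Y , A.refl i)
        where
        shrink : ∀ {k l} (p : k I.≤ i) (q : l I.≤ i) (s : l I.≤ k) →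
                 Image i (l , q) ⊆ Image i (k , p)
        shrink p q s (z , z∈Y , e) =
          map s z , closed Y s z z∈Y , A.trans i (A.sym i (D.map-∘ s p q z)) e

        directed : ∀ k l → ∃ λ m → Image i m ⊆ Image i k × Image i m ⊆ Image i l
        directed (k , p) (l , q) with lowerBound k l
        ... | m , s , s′ = (m , I.trans s p) , shrink p _ s , shrink q _ s′

      point : ∀ i → A.Carrier i
      point i = proj₁ (imagesMeet i)

      point∈Y : ∀ i → (Y ∋ i) (point i)
      point∈Y i with proj₂ (imagesMeet i) (i , I.refl)
      ... | z , z∈Y , e = resp Y i e (closed Y I.refl z z∈Y)

      -- The part of Y lying over point i: being full, it is all of Y by
      -- minimality.
      fibre : ∀ i → Subsystem
      fibre i = subsystem
        (λ j y → ∃ λ k → ∃ λ (p : k I.≤ i) → ∃ λ (q : k I.≤ j) → ∃ λ z →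
                 (Y ∋ k) z × A._≈_ i (map p z) (point i) × A._≈_ j (map q z) y)
        (λ j y (k , p , q , z , z∈Y , e , e′) →
          X-resp j e′ (X-closed q z (inside Y k z z∈Y)))
        (λ j y≈y′ (k , p , q , z , z∈Y , e , e′) →
          k , p , q , z , z∈Y , e , A.trans j e′ y≈y′)
        (λ {_} {j} s y (k , p , q , z , z∈Y , e , e′) →
          k , p , I.trans q s , z , z∈Y , e ,
          A.trans j (D.map-∘ q s (I.trans q s) z) (map-cong s e′))

      -- As `j` need not be comparable with `i`, a preimage of `point i` is taken at a common lower
      -- bound and pushed forward to `j`.
      fibre-full : ∀ i → Full (fibre i)
      fibre-full i j with lowerBound i j
      ... | k , p , q with proj₂ (imagesMeet i) (k , p)
      ...   | z , z∈Y , e =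
        map q z , fromWitness (k , p , q , z , z∈Y , e , A.refl j)

      fibre-≤ : ∀ i → fibre i ≤ Y
      fibre-≤ i j y y∈ with toWitness y∈
      ... | k , p , q , z , z∈Y , _ , e = resp Y j e (closed Y q z z∈Y)

      -- By minimality `y` lies in `fibre i`. At stage `i` itself both `y` and `point i` are then
      -- images of one `z` under maps of the same stages, and these agree.
      unique : ∀ i y → (Y ∋ i) y → A._≈_ i y (point i)
      unique i y y∈Y
        with toWitness (proj₂ (proj₂ minimalSubsystem) (fibre i) (fibre-full i) (fibre-≤ i) i y y∈Y)
      ... | k , p , q , z , _ , e , e′ =
        A.trans i (A.sym i e′) (A.trans i (map-irrelevant q p z) e)

      compatible : ∀ {i j} (p : i I.≤ j) → A._≈_ j (map p (point i)) (point j)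
      compatible {i} {j} p = unique j _ (closed Y p (point i) (point∈Y i))

      limitPoint : ∃ λ (x : Family D) → ∀ i → X i (proj₁ x i)
      limitPoint = (point , compatible) , λ i → inside Y i (point i) (point∈Y i)

-- Homomorphisms preserve existential positive formulas.

module _ {L : Language f r} {M N : Structure L ℓ} (h : Hom M N) where
  private
    module M = Structure M
    module N = Structure N
  open Hom h

  -- The environment `σ` is kept general because `to ∘ (x ∷ ρ)` and `to x ∷ (to ∘ ρ)` are equal only
  -- pointwise.
  ⟦⟧-homo : ∀ {n} (s : Term L n) {ρ : Vector M.Carrier n} {σ : Vector N.Carrier n} →
            Pointwise N._≈_ (to ∘ ρ) σ → to (⟦_⟧ M s ρ) N.≈ ⟦_⟧ N s σ
  ⟦⟧-homo (var i)    ρ≈σ = ρ≈σ i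
  ⟦⟧-homo (app F ts) ρ≈σ =
    N.trans (fun-homo F _) (N.fun-cong F λ i → ⟦⟧-homo (ts i) ρ≈σ)

  ∷-homo : ∀ {n x y} {ρ : Vector M.Carrier n} {σ : Vector N.Carrier n} →
           to x N.≈ y → Pointwise N._≈_ (to ∘ ρ) σ →
           Pointwise N._≈_ (to ∘ (x ∷ ρ)) (y ∷ σ)
  ∷-homo x≈y ρ≈σ zero    = x≈y
  ∷-homo x≈y ρ≈σ (suc i) = ρ≈σ i

  preserves : ∀ {n} {φ : Formula L n} → ExistentialPositive φ →
              ∀ {ρ : Vector M.Carrier n} {σ : Vector N.Carrier n} →
              Pointwise N._≈_ (to ∘ ρ) σ → Satisfies M φ ρ → Satisfies N φ σ
  preserves (s ≐ t) ρ≈σ e =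
    N.trans (N.sym (⟦⟧-homo s ρ≈σ)) (N.trans (to-cong e) (⟦⟧-homo t ρ≈σ))
  preserves (atom R ts) ρ≈σ Rts =
    N.rel-resp R (λ i → ⟦⟧-homo (ts i) ρ≈σ) (rel-homo R _ Rts)
  preserves (φ ∧ ψ) ρ≈σ (p , q) = preserves φ ρ≈σ p , preserves ψ ρ≈σ q
  preserves (φ ∨ ψ) ρ≈σ = Sum.map (preserves φ ρ≈σ) (preserves ψ ρ≈σ)
  preserves (ex φ) ρ≈σ (x , p) = to x , preserves φ (∷-homo N.refl ρ≈σ) p

preserves-≈ : {L : Language f r} (M : Structure L ℓ) (let open Structure M) →
              ∀ {n} {φ : Formula L n} → ExistentialPositive φ →
              ∀ {ρ σ : Vector Carrier n} → Pointwise _≈_ ρ σ →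
              Satisfies M φ ρ → Satisfies M φ σ
preserves-≈ M = preserves (idHom M)

-- Universal closures.

module _ {L : Language f r} (M : Structure L ℓ) where
  open Structure M

  ∀*-intro : ∀ {n} (φ : Formula L n) → (∀ ρ → Satisfies M φ ρ) → M ⊨ ∀* φ
  ∀*-intro {zero}  φ p = p []
  ∀*-intro {suc n} φ p = ∀*-intro (all φ) λ ρ x → p (x ∷ ρ)

  -- Environments are functions, so an instance can be had only at an
  -- environment pointwise equal to the given one.
  ∀*-elim : ∀ {n} (φ : Formula L n) → M ⊨ ∀* φ → ∀ ρ →
            ∃ λ σ → Pointwise _≈_ ρ σ × Satisfies M φ σ
  ∀*-elim {zero}  φ p ρ = [] , (λ ()) , p
  ∀*-elim {suc n} φ p ρ with ∀*-elim (all φ) p (tail ρ)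
  ... | σ , ρ≈σ , q = head ρ ∷ σ , (λ { zero → refl ; (suc i) → ρ≈σ i }) , q (head ρ)

-- Arbitrary limits compared with compatible families.

module _ {L : Language f r} {I : Poset ℓ ℓ ℓ} (D : Diagram L I)
         (C : Cone D) (isLimit : IsLimit D C) where
  private
    module I = Poset I
    module D = Diagram D
    module A (i : I.Carrier) = Structure (D.obj i)
    module M = Structure (Cone.apex C)
  open Cone C
  open IsLimit isLimit

  private
    family : Hom apex (limitStructure D)
    family = IsLimit.mediator (limitCone-isLimit D) C

    glue : Hom (limitStructure D) apex
    glue = mediator (limitCone D)

    -- Both `glue ⊚ family` and the identity commute with the projections, so uniqueness identifies
    -- them. Through this, stagewise equalities and relations pass to the apex.
    glue-family : ∀ x → Hom.to glue (Hom.to family x) M.≈ x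
    glue-family x = M.trans
      (unique C (glue ⊚ family) (λ i y → factor (limitCone D) i (Hom.to family y)) x)
      (M.sym (unique C (idHom apex) (λ i y → A.refl i) x))

  realise : (x : Family D) → ∃ λ y → ∀ i → A._≈_ i (Hom.to (proj i) y) (proj₁ x i)
  realise x = Hom.to glue x , λ i → factor (limitCone D) i x

  jointly-injective : ∀ {x y} → (∀ i → A._≈_ i (Hom.to (proj i) x) (Hom.to (proj i) y)) →
                      x M.≈ y
  jointly-injective e =
    M.trans (M.sym (glue-family _)) (M.trans (Hom.to-cong glue e) (glue-family _))

  jointly-reflects : ∀ {m} (R : Language.Rel L m) xs →
                     (∀ i → A.rel i R (Hom.to (proj i) ∘ xs)) → M.rel R xs
  jointly-reflects R xs h =
    M.rel-resp R (glue-family ∘ xs) (Hom.rel-homo glue R (Hom.to family ∘ xs) h)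

-- Truth in a limit of finite structures.

module ProfiniteModels
  (choice : ∀ c → AxiomOfChoice c)
  {L : Language f r} {I : Poset ℓ ℓ ℓ} (dir : DownwardDirected I) (D : Diagram L I)
  (finite : ∀ i → Finite (Diagram.obj D i)) (C : Cone D) (isLimit : IsLimit D C)
  where

  private
    module I = Poset I
    module D = Diagram D
    module A (i : I.Carrier) = Structure (D.obj i)
    M = Cone.apex C
    module M = Structure M
  open Classical choice
  open Cone C using (proj; commute)
  open DownwardDirected dir

  stage : ∀ {n} → Vector M.Carrier n → ∀ i → Vector (A.Carrier i) n
  stage ρ i = Hom.to (proj i) ∘ ρ

  reflects : ∀ {n} {φ : Formula L n} → ExistentialPositive φ → ∀ ρ →
             (∀ i → Satisfies (D.obj i) φ (stage ρ i)) → Satisfies M φ ρ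
  reflects (s ≐ t) ρ p = jointly-injective D C isLimit λ i →
    A.trans i (⟦⟧-homo (proj i) s λ _ → A.refl i)
      (A.trans i (p i) (A.sym i (⟦⟧-homo (proj i) t λ _ → A.refl i)))
  reflects (atom R ts) ρ p = jointly-reflects D C isLimit R _ λ i →
    A.rel-resp i R (λ k → A.sym i (⟦⟧-homo (proj i) (ts k) λ _ → A.refl i)) (p i)
  reflects (φ ∧ ψ) ρ p = reflects φ ρ (proj₁ ∘ p) , reflects ψ ρ (proj₂ ∘ p)
  reflects (_∨_ {φ} {ψ} φ⁺ ψ⁺) ρ p with em {P = ∀ i → Satisfies (D.obj i) φ (stage ρ i)}
  ... | yes ∀φ = inj₁ (reflects φ⁺ ρ ∀φ)
  ... | no ¬∀φ with ¬∀⇒∃¬ ¬∀φ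
  -- Failure of `φ` at `i` passes to every stage below `i`. Below both `i` and `j` it is therefore
  -- `ψ` that holds, and it is carried up to `j`.
  ...   | i , ¬φ = inj₂ (reflects ψ⁺ ρ λ j →
    let l , l≤i , l≤j = lowerBound i j in
    Sum.[ (λ φl → ⊥-elim (¬φ (preserves (D.map l≤i) φ⁺ (λ k → commute l≤i (ρ k)) φl)))
        , preserves (D.map l≤j) ψ⁺ (λ k → commute l≤j (ρ k))
        ] (p l))
  reflects (ex {φ} φ⁺) ρ p = y , reflects φ⁺ (y ∷ ρ) λ i →
    preserves-≈ (D.obj i) φ⁺
      (λ { zero → A.sym i (y≈x i) ; (suc _) → A.refl i }) (proj₂ witnesses i)
    where
    witnesses : ∃ λ (x : Family D) → ∀ i → Satisfies (D.obj i) φ (proj₁ x i ∷ stage ρ i)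
    witnesses = limitPoint dir D finite
      (λ i x → Satisfies (D.obj i) φ (x ∷ stage ρ i))
      (λ i x≈y → preserves-≈ (D.obj i) φ⁺
        (∷-homo (idHom (D.obj i)) x≈y λ _ → A.refl i))
      (λ q x → preserves (D.map q) φ⁺
        (∷-homo (D.map q) (A.refl _) λ k → commute q (ρ k)))
      p

    y   = proj₁ (realise D C isLimit (proj₁ witnesses))
    y≈x = proj₂ (realise D C isLimit (proj₁ witnesses))

  -- The point of `M` and its projections make every structure involved nonempty, so both
  -- equivalences are available throughout. Only `φ′` and `ψ′` are moved between structures and
  -- environments.
  implication-closed : M.Carrier → ∀ {n} (φ ψ : Formula L n) → φ ∈ ∃⁺ ℓ → ψ ∈ ∃⁺ ℓ →
                       (∀ i → D.obj i ⊨ ∀* (φ ⇒ ψ)) → M ⊨ ∀* (φ ⇒ ψ)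
  implication-closed x φ ψ (φ′ , φ⁺ , φ⇔φ′) (ψ′ , ψ⁺ , ψ⇔ψ′) p =
    ∀*-intro M (φ ⇒ ψ) λ ρ φρ → Equivalence.from (ψ⇔ψ′ M x ρ) (reflects ψ⁺ ρ λ i →
      let A = D.obj i
          a = Hom.to (proj i) x
          σ , ρ≈σ , φ⇒ψ = ∀*-elim A (φ ⇒ ψ) (p i) (stage ρ i)
          φ′σ = preserves (proj i) φ⁺ ρ≈σ (Equivalence.to (φ⇔φ′ M x ρ) φρ)
          ψ′σ = Equivalence.to (ψ⇔ψ′ A a σ) (φ⇒ψ (Equivalence.from (φ⇔φ′ A a σ) φ′σ))
      in preserves-≈ A ψ⁺ (λ k → A.sym i (ρ≈σ k)) ψ′σ)

  -- Empty limits.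

  module _ (M-empty : ¬ M.Carrier) where

    -- If all stages were inhabited, the full inverse system would have a compatible family,
    -- realised by a point of `M`.
    emptyStage : ∃ λ i → ¬ A.Carrier i
    emptyStage = ¬∀⇒∃¬ λ x → M-empty (proj₁ (realise D C isLimit (proj₁
      (limitPoint dir D finite (λ _ _ → ⊤) (λ _ _ _ → tt) (λ _ _ _ → tt)
        (λ i → x i , tt)))))

    AgreesBelow : Sentence L → I.Carrier → Set ℓ
    AgreesBelow σ i = ∀ j → j I.≤ i → Satisfies M σ [] ⇔ Satisfies (D.obj j) σ []

    -- Truth at all stages reaches the limit by `reflects`. Falsity at one stage spreads to the
    -- stages below it and to the limit, as homomorphisms preserve truth.
    existentialPositive-stabilises : ∀ {σ} → ExistentialPositive σ → ∃ (AgreesBelow σ)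
    existentialPositive-stabilises {σ} σ⁺ with em {P = ∀ i → Satisfies (D.obj i) σ (stage [] i)}
    ... | yes ∀σ = inhabitant , λ j _ → mk⇔
      (preserves (proj j) σ⁺ λ ())
      (λ _ → reflects σ⁺ [] ∀σ)
    ... | no ¬∀σ with ¬∀⇒∃¬ ¬∀σ
    ...   | i , ¬σ = i , λ j j≤i → mk⇔
      (λ σM → ⊥-elim (¬σ (preserves (proj i) σ⁺ (λ ()) σM)))
      (λ σj → ⊥-elim (¬σ (preserves (D.map j≤i) σ⁺ (λ ()) σj)))

    stabilises₂ : ∀ σ τ υ →
      (∀ {j} → Satisfies M σ [] ⇔ Satisfies (D.obj j) σ [] →
               Satisfies M τ [] ⇔ Satisfies (D.obj j) τ [] →
               Satisfies M υ [] ⇔ Satisfies (D.obj j) υ []) →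
      ∃ (AgreesBelow σ) → ∃ (AgreesBelow τ) → ∃ (AgreesBelow υ)
    stabilises₂ _ _ _ combine (i , σ≤i) (j , τ≤j) =
      let l , l≤i , l≤j = lowerBound i j in
      l , λ k k≤l → combine (σ≤i k (I.trans k≤l l≤i)) (τ≤j k (I.trans k≤l l≤j))

    -- Every stage below an empty one is empty, so there, as in `M`, each `all φ` is true and each
    -- `ex φ` false. The induction never goes under a quantifier.
    stabilises : ∀ σ → ∃ (AgreesBelow σ)
    stabilises (s ≐ t)     = existentialPositive-stabilises (s ≐ t)
    stabilises (atom R ts) = existentialPositive-stabilises (atom R ts)
    stabilises (~ σ)       = let i , agree = stabilises σ in
      i , λ j → ¬-cong-⇔ ∘ agree j
    stabilises (σ ∧ τ)     =
      stabilises₂ σ τ (σ ∧ τ) _×-⇔_ (stabilises σ) (stabilises τ)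
    stabilises (σ ∨ τ)     =
      stabilises₂ σ τ (σ ∨ τ) _⊎-⇔_ (stabilises σ) (stabilises τ)
    stabilises (σ ⇒ τ)     =
      stabilises₂ σ τ (σ ⇒ τ) →-cong-⇔ (stabilises σ) (stabilises τ)
    stabilises (all φ)     = let i , empty = emptyStage in i , λ j j≤i → mk⇔
      (λ _ x → ⊥-elim (empty (Hom.to (D.map j≤i) x)))
      (λ _ x → ⊥-elim (M-empty x))
    stabilises (ex φ)      = let i , empty = emptyStage in i , λ j j≤i → mk⇔
      (λ (x , _) → ⊥-elim (M-empty x))
      (λ (x , _) → ⊥-elim (empty (Hom.to (D.map j≤i) x)))

    empty-closed : ∀ σ → (∀ i → D.obj i ⊨ σ) → M ⊨ σ
    empty-closed σ p =
      let i , agree = stabilises σ in Equivalence.from (agree i I.refl) (p i)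

  ∃⁺-Implication-closed : ∀ {σ} → σ ∈ ∃⁺-Implication ℓ → (∀ i → D.obj i ⊨ σ) → M ⊨ σ
  ∃⁺-Implication-closed {σ} (implication φ ψ φ∈ ψ∈) p with em {P = M.Carrier}
  ... | yes x      = implication-closed x φ ψ φ∈ ψ∈ p
  ... | no M-empty = empty-closed M-empty σ p

corollary22 : (∀ c → AxiomOfChoice c) →
    ∀ {f r t ℓ : Level} (L : Language f r) (T : Theory L t) →
    (∀ σ → σ ∈ T → σ ∈ ∃⁺-Implication ℓ) →
    HasProfiniteObjects (Mod T ℓ)
corollary22 choice L T axioms I dir D finite models C isLimit σ σ∈T =
  ∃⁺-Implication-closed (axioms σ σ∈T) λ i → models i σ σ∈T
  where open ProfiniteModels choice dir D finite C isLimit
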